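{- The calculus RD is cut-free complete for serial models: for every hypersequent $H$, if no model based on a serial frame is a counter-example to $H$, then $H$ has a derivation in RD that does not use the Cut rule.
   Context: **Language.** Modal formulas are built from propositional variables by $\lnot,\land,\Box$. A frame is $\langle W,R\rangle$ with $W\neq\emptyset$, $R\subseteq W\times W$; it is serial iff for every $w\in W$ there is $v\in W$ with $wRv$. A model $\mathfrak M=\langle W,R,V\rangle$ adds a valuation, and truth $\mathfrak M,w\models\varphi$ is the usual Kripke truth definition ($\Box\varphi$ is true at $w$ iff $\varphi$ is true at every $v$ with $wRv$). **Hypersequents.** A sequent is an expression $\Gamma\Rightarrow\Delta$ with $\Gamma,\Delta$ finite sets of formulas (written as comma-separated lists; $\varphi,\Gamma$ means $\{\varphi\}\cup\Gamma$, and $\varphi\in\Gamma$ is allowed). A hypersequent is a finite nonempty sequence of sequents $S_1\;/\!/\;\dots\;/\!/\; S_n$ (order and multiplicity matter). **Semantics.** $\mathfrak M$ is a countermodel to $\Gamma\Rightarrow\Delta$ at $w$ iff $\mathfrak M,w\models\varphi$ for all $\varphi\in\Gamma$ and $\mathfrak M,w\not\models\psi$ for all $\psi\in\Delta$. $\mathfrak M$ is a counter-example to $\Gamma_1\Rightarrow\Delta_1\;/\!/\;\dots\;/\!/\;\Gamma_n\Rightarrow\Delta_n$ iff there are worlds $w_1,\dots,w_n$ with $w_iRw_{i+1}$ for $1\le i<n$ such that $\mathfrak M$ is a countermodel to $\Gamma_i\Rightarrow\Delta_i$ at $w_i$ for every $i$. **The calculus RK.** Derivations are finite trees of hypersequents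 whose leaves are axioms $\varphi\Rightarrow\varphi$ (one-component hypersequents) and which are built by the following rules. Here $G,H$ are possibly empty sequences of sequents unless otherwise said; "premise(s) / conclusion". - WL: $G\;/\!/\;\Gamma\Rightarrow\Delta\;/\!/\; H$ / $G\;/\!/\;\varphi,\Gamma\Rightarrow\Delta\;/\!/\; H$. - WR: $G\;/\!/\;\Gamma\Rightarrow\Delta\;/\!/\; H$ / $G\;/\!/\;\Gamma\Rightarrow\Delta,\varphi\;/\!/\; H$. - Cut: $G\;/\!/\;\Gamma\Rightarrow\Delta,\varphi\;/\!/\; H$ and $G\;/\!/\;\varphi,\Lambda\Rightarrow\Theta\;/\!/\; H$ / $G\;/\!/\;\Gamma,\Lambda\Rightarrow\Delta,\Theta\;/\!/\; H$. - EWR: $G$ / $G\;/\!/\;\ \Rightarrow\ $ ($G$ a hypersequent; an empty sequent is appended on the right). - EWL: $G$ / $\ \Rightarrow\ \;/\!/\; G$ ($G$ a hypersequent; an empty sequent is prepended on the left). - $\lnot$L: $G\;/\!/\;\Gamma\Rightarrow\Delta,\varphi\;/\!/\; H$ / $G\;/\!/\;\lnot\varphi,\Gamma\Rightarrow\Delta\;/\!/\; H$. - $\lnot$R: $G\;/\!/\;\varphi,\Gamma\Rightarrow\Delta\;/\!/\; H$ / $G\;/\!/\;\Gamma\Rightarrow\Delta,\lnot\varphi\;/\!/\; H$. - $\land$L$_1$: $G\;/\!/\;\varphi,\Gamma\Rightarrow\Delta\;/\!/\; H$ / $G\;/\!/\;\varphi\land\psi,\Gamma\Rightarrow\Delta\;/\!/\;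 H$. - $\land$L$_2$: $G\;/\!/\;\psi,\Gamma\Rightarrow\Delta\;/\!/\; H$ / $G\;/\!/\;\varphi\land\psi,\Gamma\Rightarrow\Delta\;/\!/\; H$. - $\land$R: $G\;/\!/\;\Gamma\Rightarrow\Delta,\varphi\;/\!/\; H$ and $G\;/\!/\;\Gamma\Rightarrow\Delta,\psi\;/\!/\; H$ / $G\;/\!/\;\Gamma\Rightarrow\Delta,\varphi\land\psi\;/\!/\; H$. - $\Box$L: $G\;/\!/\;\Gamma\Rightarrow\Delta\;/\!/\;\varphi,\Lambda\Rightarrow\Theta\;/\!/\; H$ / $G\;/\!/\;\Box\varphi,\Gamma\Rightarrow\Delta\;/\!/\;\Lambda\Rightarrow\Theta\;/\!/\; H$. - $\Box$R: $H\;/\!/\;\Gamma\Rightarrow\Delta\;/\!/\;\ \Rightarrow\varphi$ / $H\;/\!/\;\Gamma\Rightarrow\Delta,\Box\varphi$ (the active components are rightmost). **The calculus RD** is RK together with the rule Drop: $G\;/\!/\;\ \Rightarrow\ $ / $G$ ($G$ a hypersequent; an empty rightmost sequent is deleted). -}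

module Defs where

open import Data.Empty using (⊥)
open import Data.List.Base using (List; []; _∷_; [_]; _++_)
open import Data.List.NonEmpty.Base using (List⁺; _∷_; toList; _++⁺_; _∷⁺_; _⁺∷ʳ_)
open import Data.List.Relation.Binary.BagAndSetEquality using (_∼[_]_; set)
open import Data.List.Relation.Binary.Pointwise.Base using (Pointwise)
open import Data.List.Relation.Unary.All using (All; []; _∷_)
open import Data.List.Relation.Unary.Linked using (Linked)
open import Data.Nat.Base using (ℕ)
open import Data.Product.Base using (∃-syntax; _×_)
open import Data.Unit.Base using (⊤)
open import Relation.Nullary.Negation.Core using (¬_)

infix  30 `¬_ □_
infixr 25 _`∧_

data Formula : Set where
  var  : ℕ → Formula
  `¬_  : Formula → Formula
  _`∧_ : Formula → Formula → Formula
  □_   : Formula → Formula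

record Frame : Set₁ where
  field
    W         : Set
    R         : W → W → Set
    inhabited : W

Serial : Frame → Set
Serial F = ∀ w → ∃[ v ] R w v
  where open Frame F

record Model : Set₁ where
  field
    frame : Frame
  open Frame frame public
  field
    V : ℕ → W → Set

infix 4 _,_⊨_

_,_⊨_ : (M : Model) → Model.W M → Formula → Set
M , w ⊨ var p    = Model.V M p w
M , w ⊨ `¬ φ     = ¬ (M , w ⊨ φ)
M , w ⊨ (φ `∧ ψ) = (M , w ⊨ φ) × (M , w ⊨ ψ)
M , w ⊨ □ φ      = ∀ v → Model.R M w v → M , v ⊨ φ

-- Finite sets of formulas are represented by lists.  They are identified up
-- to set equality (same members) by _≈_ below, so that φ ∷ Γ stands for
-- {φ} ∪ Γ (φ may already occur in Γ) and Γ ++ Λ for Γ ∪ Λ.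
infix 4 _⇒_

record Sequent : Set where
  constructor _⇒_
  field
    antecedent : List Formula
    succedent  : List Formula

open Sequent public

Hypersequent : Set
Hypersequent = List⁺ Sequent

infix 3 _≈ˢ_ _≈_

_≈ˢ_ : Sequent → Sequent → Set
S ≈ˢ T = (antecedent S ∼[ set ] antecedent T) × (succedent S ∼[ set ] succedent T)

_≈_ : Hypersequent → Hypersequent → Set
G ≈ H = Pointwise _≈ˢ_ (toList G) (toList H)

Countermodel : (M : Model) → Model.W M → Sequent → Set
Countermodel M w (Γ ⇒ Δ) = All (λ φ → M , w ⊨ φ) Γ × All (λ ψ → ¬ (M , w ⊨ ψ)) Δ

CounterExample : Model → Hypersequent → Set
CounterExample M H =
  ∃[ ws ] Linked (Model.R M) ws × Pointwise (Countermodel M) ws (toList H)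

∅ : Sequent
∅ = [] ⇒ []

Calculus : Set₁
Calculus = List Hypersequent → Hypersequent → Set

data RK : Calculus where
  ax  : ∀ {φ} → RK [] (([ φ ] ⇒ [ φ ]) ∷ [])
  WL  : ∀ {G H Γ Δ φ} →
        RK [ G ++⁺ ((Γ ⇒ Δ) ∷ H) ]
           (G ++⁺ ((φ ∷ Γ ⇒ Δ) ∷ H))
  WR  : ∀ {G H Γ Δ φ} →
        RK [ G ++⁺ ((Γ ⇒ Δ) ∷ H) ]
           (G ++⁺ ((Γ ⇒ φ ∷ Δ) ∷ H))
  Cut : ∀ {G H Γ Δ Λ Θ φ} →
        RK ((G ++⁺ ((Γ ⇒ φ ∷ Δ) ∷ H)) ∷ (G ++⁺ ((φ ∷ Λ ⇒ Θ) ∷ H)) ∷ [])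
           (G ++⁺ ((Γ ++ Λ ⇒ Δ ++ Θ) ∷ H))
  EWR : ∀ {G} → RK [ G ] (G ⁺∷ʳ ∅)
  EWL : ∀ {G} → RK [ G ] (∅ ∷⁺ G)
  ¬L  : ∀ {G H Γ Δ φ} →
        RK [ G ++⁺ ((Γ ⇒ φ ∷ Δ) ∷ H) ]
           (G ++⁺ ((`¬ φ ∷ Γ ⇒ Δ) ∷ H))
  ¬R  : ∀ {G H Γ Δ φ} →
        RK [ G ++⁺ ((φ ∷ Γ ⇒ Δ) ∷ H) ]
           (G ++⁺ ((Γ ⇒ `¬ φ ∷ Δ) ∷ H))
  ∧L₁ : ∀ {G H Γ Δ φ ψ} →
        RK [ G ++⁺ ((φ ∷ Γ ⇒ Δ) ∷ H) ]
           (G ++⁺ ((φ `∧ ψ ∷ Γ ⇒ Δ) ∷ H))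
  ∧L₂ : ∀ {G H Γ Δ φ ψ} →
        RK [ G ++⁺ ((ψ ∷ Γ ⇒ Δ) ∷ H) ]
           (G ++⁺ ((φ `∧ ψ ∷ Γ ⇒ Δ) ∷ H))
  ∧R  : ∀ {G H Γ Δ φ ψ} →
        RK ((G ++⁺ ((Γ ⇒ φ ∷ Δ) ∷ H)) ∷ (G ++⁺ ((Γ ⇒ ψ ∷ Δ) ∷ H)) ∷ [])
           (G ++⁺ ((Γ ⇒ φ `∧ ψ ∷ Δ) ∷ H))
  □L  : ∀ {G H Γ Δ Λ Θ φ} →
        RK [ G ++⁺ ((Γ ⇒ Δ) ∷ (φ ∷ Λ ⇒ Θ) ∷ H) ]
           (G ++⁺ ((□ φ ∷ Γ ⇒ Δ) ∷ (Λ ⇒ Θ) ∷ H))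
  □R  : ∀ {H Γ Δ φ} →
        RK [ H ++⁺ ((Γ ⇒ Δ) ∷ ([] ⇒ [ φ ]) ∷ []) ]
           (H ++⁺ ((Γ ⇒ □ φ ∷ Δ) ∷ []))

data RD : Calculus where
  rk   : ∀ {Gs H} → RK Gs H → RD Gs H
  Drop : ∀ {G} → RD [ G ⁺∷ʳ ∅ ] G

IsCut : ∀ {Gs H} → RD Gs H → Set
IsCut (rk Cut) = ⊤
IsCut _        = ⊥

-- The conclusion of a rule instance is taken modulo _≈_: hypersequents are
-- built from sets, of which the lists are mere representatives.
data Derivation (C : Calculus) : Hypersequent → Set where
  infer : ∀ {Gs H H′} → C Gs H → H ≈ H′ → All (Derivation C) Gs → Derivation C H′

CutFree  : ∀ {H} → Derivation RD H → Set
CutFree* : ∀ {Gs} → All (Derivation RD) Gs → Set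
CutFree  (infer r _ ds) = ¬ IsCut r × CutFree* ds
CutFree* []             = ⊤
CutFree* (d ∷ ds)       = CutFree d × CutFree* ds

{-# OPTIONS --safe #-}

-- In K and D, boxed formulas only pass information from left to right.  So for
-- any sequent S and list H of sequents one decides between cut-free derivations
-- of G // S // H, uniform in the prefix G, and a serial counter-example to
-- S // H.  The propositional rules are invertible, which reduces S to a sequent
-- Γ ⇒ Δ of variables and boxed formulas.  Write Γ′ for {φ | □φ ∈ Γ}.  Then
-- G // Γ ⇒ Δ // H is derivable as soon as Γ and Δ share a variable, or Γ′ ⇒ φ
-- is derivable in every context G for some □φ ∈ Δ (by □R and □L), or H is
-- Λ ⇒ Θ // H′ with Γ′,Λ ⇒ Θ // H′ derivable in every context (by □L); if H is
-- empty, Drop supplies an empty component to serve as Λ ⇒ Θ.  If all of these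
-- fail, the counter-examples found are glued below a new root refuting Γ ⇒ Δ;
-- thanks to Drop there is always at least one, so the root has a successor.
module Submission where

open import Defs
open import Data.Empty using (⊥-elim)
open import Data.List.Base using (List; []; _∷_; [_]; _++_; concatMap; map)
open import Data.List.Extrema.Nat using (max; xs≤max)
open import Data.List.Membership.Propositional using (_∈_; _∉_)
open import Data.List.NonEmpty.Base using (_∷_; _++⁺_; _∷⁺_; _⁺∷ʳ_)
open import Data.List.Properties using (++-identityʳ; map-id)
open import Data.List.Relation.Binary.BagAndSetEquality
  using (_∼[_]_; set; [_]-Equality; ↭⇒∼bag; bag-=⇒)
open import Data.List.Relation.Binary.Permutation.Propositional using (↭-swap; ↭-refl)
open import Data.List.Relation.Binary.Permutation.Propositional.Properties using (shift; ++-comm)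
open import Data.List.Relation.Binary.Pointwise as Pointwise using ([]; _∷_)
open import Data.List.Relation.Unary.All as All using (All; []; _∷_)
open import Data.List.Relation.Unary.All.Properties
  using (anti-mono; map⁻; concat⁻; ++⁻; ++⁻ˡ; ++⁻ʳ; singleton⁻) renaming (++⁺ to All-++⁺)
open import Data.List.Relation.Unary.Any using (here; there; any?)
open import Data.List.Relation.Unary.Linked as Linked using ([-]; _∷_)
import Data.List.Relation.Unary.Linked.Properties as LinkedProps
open import Data.Maybe.Base using (Maybe; just; nothing)
open import Data.Nat.Base using (ℕ; zero; suc; _⊔_; _<_; s≤s; s<s⁻¹)
open import Data.Nat.Properties using (_≟_; m<n⇒m<1+n; m⊔n<o⇒m<o; m⊔n<o⇒n<o)
open import Data.Product.Base using (Σ-syntax; _×_; _,_; proj₁; proj₂; map₁)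
open import Data.Sum.Base using (_⊎_; inj₁; inj₂)
open import Data.Unit.Base using (⊤; tt)
open import Function.Base using (_∘_; id)
open import Function.Bundles using (_⇔_; mk⇔; Equivalence)
open import Level using (Level)
open import Relation.Binary.Bundles using (Setoid)
open import Relation.Binary.PropositionalEquality using (_≡_; refl; sym; cong; subst; subst₂)
open import Relation.Nullary.Decidable using (Dec; yes; no; map′)
open import Relation.Nullary.Negation.Core using (¬_)

open Model using (W; R; V; frame)
open module ∼ = Setoid ([ set ]-Equality Formula) using ()
  renaming (refl to ∼-refl; trans to ∼-trans)
open Equivalence using (to; from)

private variable
  ℓ ℓ′ ℓ″ : Level
  G H : List Sequent
  S T : Sequent
  Γ Δ Λ Θ : List Formula
  φ ψ : Formula
  d : ℕ

-- Lists as finite sets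

absorb : φ ∈ Γ → φ ∷ Γ ∼[ set ] Γ
absorb φ∈Γ = mk⇔ (λ { (here refl) → φ∈Γ ; (there m) → m }) there

absorb-∈ : φ ∈ Γ → Γ ++ [ φ ] ∼[ set ] Γ
absorb-∈ φ∈Γ = ∼-trans (bag-=⇒ (↭⇒∼bag (++-comm _ [ _ ]))) (absorb φ∈Γ)

swap : φ ∷ ψ ∷ Γ ∼[ set ] ψ ∷ φ ∷ Γ
swap = bag-=⇒ (↭⇒∼bag (↭-swap _ _ ↭-refl))

-- Cut-free derivability

infix 3 ⊢_

⊢_ : Hypersequent → Set
⊢ H = Σ[ d ∈ Derivation RD H ] CutFree d

≈ˢ-refl : S ≈ˢ S
≈ˢ-refl = ∼-refl , ∼-refl

⊢-resp : ∀ {H H′} → H ≈ H′ → ⊢ H → ⊢ H′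
⊢-resp e′ (infer r e ds , cf) = infer r (Pointwise.transitive ≈ˢ-trans e e′) ds , cf
  where
  ≈ˢ-trans : ∀ {S T U} → S ≈ˢ T → T ≈ˢ U → S ≈ˢ U
  ≈ˢ-trans (p , q) (p′ , q′) = ∼-trans p p′ , ∼-trans q q′

⊢-resp-at : ∀ G → S ≈ˢ T → ⊢ G ++⁺ (S ∷ H) → ⊢ G ++⁺ (T ∷ H)
⊢-resp-at {S} {T} {H} G S≈T = ⊢-resp (go G)
  where
  go : ∀ G → G ++⁺ (S ∷ H) ≈ G ++⁺ (T ∷ H)
  go []      = S≈T ∷ Pointwise.refl ≈ˢ-refl
  go (_ ∷ G) = ≈ˢ-refl ∷ go G

infer₁ : ∀ {H H′} (r : RD [ H ] H′) → ¬ IsCut r → ⊢ H → ⊢ H′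
infer₁ r nc (d , cf) = infer r (Pointwise.refl ≈ˢ-refl) (d ∷ []) , nc , cf , tt

infer₂ : ∀ {H₁ H₂ H′} (r : RD (H₁ ∷ [ H₂ ]) H′) → ¬ IsCut r → ⊢ H₁ → ⊢ H₂ → ⊢ H′
infer₂ r nc (d₁ , cf₁) (d₂ , cf₂) =
  infer r (Pointwise.refl ≈ˢ-refl) (d₁ ∷ d₂ ∷ []) , nc , cf₁ , cf₂ , tt

⊢-weaken : ∀ G A B → ⊢ G ++⁺ ((Γ ⇒ Δ) ∷ H) → ⊢ G ++⁺ ((A ++ Γ ⇒ B ++ Δ) ∷ H)
⊢-weaken G []      []      = id
⊢-weaken G []      (φ ∷ B) = infer₁ (rk (WR {G = G})) id ∘ ⊢-weaken G [] B
⊢-weaken G (φ ∷ A) B       = infer₁ (rk (WL {G = G})) id ∘ ⊢-weaken G A B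

-- `EWL` and `EWR` create only empty components; internal weakening then turns these into arbitrary
-- sequents.
⊢-fill : ∀ G T → ⊢ G ++⁺ (∅ ∷ H) → ⊢ G ++⁺ (T ∷ H)
⊢-fill {H} G (Γ ⇒ Δ) ⊢∅ =
  subst₂ (λ Γ Δ → ⊢ G ++⁺ ((Γ ⇒ Δ) ∷ H)) (++-identityʳ Γ) (++-identityʳ Δ) (⊢-weaken G Γ Δ ⊢∅)

++⁺-⁺∷ʳ : ∀ (G : List Sequent) S H T → (G ++⁺ (S ∷ H)) ⁺∷ʳ T ≡ G ++⁺ (S ∷ (H ++ [ T ]))
++⁺-⁺∷ʳ []      S H T = refl
++⁺-⁺∷ʳ (U ∷ G) S H T = cong (U ∷⁺_) (++⁺-⁺∷ʳ G S H T)

++⁺-regroup : ∀ (G : List Sequent) S T H → (G ++ [ S ]) ++⁺ (T ∷ H) ≡ G ++⁺ (S ∷ T ∷ H)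
++⁺-regroup []      S T H = refl
++⁺-regroup (U ∷ G) S T H = cong (U ∷⁺_) (++⁺-regroup G S T H)

⊢-prepend : ∀ G → ⊢ S ∷ H → ⊢ G ++⁺ (S ∷ H)
⊢-prepend []      ⊢H = ⊢H
⊢-prepend (T ∷ G) ⊢H = ⊢-fill [] T (infer₁ (rk EWL) id (⊢-prepend G ⊢H))

-- `EWR` acts only at the right end, so the components of `H` are created from left to right, each
-- filled before the next.
⊢-append : ∀ G S H → ⊢ G ++⁺ (S ∷ []) → ⊢ G ++⁺ (S ∷ H)
⊢-append G S []      ⊢S = ⊢S
⊢-append G S (T ∷ H) ⊢S =
  subst ⊢_ (++⁺-regroup G S T H)
    (⊢-append (G ++ [ S ]) T H (⊢-fill (G ++ [ S ]) T
      (subst ⊢_ (sym (++⁺-regroup G S ∅ []))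
        (subst ⊢_ (++⁺-⁺∷ʳ G S [] ∅) (infer₁ (rk EWR) id ⊢S)))))

⊢-drop : ∀ G → ⊢ G ++⁺ (S ∷ [ ∅ ]) → ⊢ G ++⁺ (S ∷ [])
⊢-drop {S} G = infer₁ Drop id ∘ subst ⊢_ (sym (++⁺-⁺∷ʳ G S [] ∅))

⊢-axiom : ∀ G H → φ ∈ Γ → φ ∈ Δ → ⊢ G ++⁺ ((Γ ⇒ Δ) ∷ H)
⊢-axiom {Γ = Γ} {Δ = Δ} G H φ∈Γ φ∈Δ =
  ⊢-append G (Γ ⇒ Δ) H
    -- The axiom is weakened by all of `Γ` and `Δ`; the extra `φ` at the end vanishes because lists
    -- count as sets.
    (⊢-resp-at G (absorb-∈ φ∈Γ , absorb-∈ φ∈Δ)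
      (⊢-weaken G Γ Δ (⊢-prepend G (infer (rk ax) (Pointwise.refl ≈ˢ-refl) [] , id , tt))))

-- Both left rules are applied and the two copies of the conjunction merge. Unlike either rule
-- alone, this form is invertible.
⊢-∧L : ∀ G → ⊢ G ++⁺ ((φ ∷ ψ ∷ Γ ⇒ Δ) ∷ H) → ⊢ G ++⁺ ((φ `∧ ψ ∷ Γ ⇒ Δ) ∷ H)
⊢-∧L G =
  ⊢-resp-at G (absorb (here refl) , ∼-refl) ∘ infer₁ (rk (∧L₂ {G = G})) id ∘
  ⊢-resp-at G (swap , ∼-refl) ∘ infer₁ (rk (∧L₁ {G = G})) id

-- The box that each `□L` introduces is already in `Γ`, so the left component stays the same set.
⊢-□L : ∀ G Ψ → All (λ ψ → □ ψ ∈ Γ) Ψ →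
       ⊢ G ++⁺ ((Γ ⇒ Δ) ∷ (Ψ ++ Λ ⇒ Θ) ∷ H) → ⊢ G ++⁺ ((Γ ⇒ Δ) ∷ (Λ ⇒ Θ) ∷ H)
⊢-□L G []      []         = id
⊢-□L G (ψ ∷ Ψ) (□ψ∈ ∷ Ψ∈) =
  ⊢-□L G Ψ Ψ∈ ∘ ⊢-resp-at G (absorb □ψ∈ , ∼-refl) ∘ infer₁ (rk (□L {G = G})) id

□⁻¹ : List Formula → List Formula
□⁻¹ []             = []
□⁻¹ (var _ ∷ Γ)    = □⁻¹ Γ
□⁻¹ ((`¬ _) ∷ Γ)   = □⁻¹ Γ
□⁻¹ ((_ `∧ _) ∷ Γ) = □⁻¹ Γ
□⁻¹ ((□ φ) ∷ Γ)    = φ ∷ □⁻¹ Γ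

∈-□⁻¹ : □ φ ∈ Γ → φ ∈ □⁻¹ Γ
∈-□⁻¹ {Γ = var _ ∷ _}    (there m)   = ∈-□⁻¹ m
∈-□⁻¹ {Γ = (`¬ _) ∷ _}   (there m)   = ∈-□⁻¹ m
∈-□⁻¹ {Γ = (_ `∧ _) ∷ _} (there m)   = ∈-□⁻¹ m
∈-□⁻¹ {Γ = (□ _) ∷ _}    (here refl) = here refl
∈-□⁻¹ {Γ = (□ _) ∷ _}    (there m)   = there (∈-□⁻¹ m)

□⁻¹-boxed : ∀ Γ → All (λ ψ → □ ψ ∈ Γ) (□⁻¹ Γ)
□⁻¹-boxed []             = []
□⁻¹-boxed (var _ ∷ Γ)    = All.map there (□⁻¹-boxed Γ)
□⁻¹-boxed ((`¬ _) ∷ Γ)   = All.map there (□⁻¹-boxed Γ)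
□⁻¹-boxed ((_ `∧ _) ∷ Γ) = All.map there (□⁻¹-boxed Γ)
□⁻¹-boxed ((□ φ) ∷ Γ)    = here refl ∷ All.map there (□⁻¹-boxed Γ)

⊢-push : ∀ G → ⊢ G ++⁺ ((Γ ⇒ Δ) ∷ (□⁻¹ Γ ++ Λ ⇒ Θ) ∷ H) → ⊢ G ++⁺ ((Γ ⇒ Δ) ∷ (Λ ⇒ Θ) ∷ H)
⊢-push {Γ = Γ} G = ⊢-□L G (□⁻¹ Γ) (□⁻¹-boxed Γ)

-- `□R` wants its active components rightmost, so `H` is added afterwards by weakening.
⊢-□R : ∀ G H → □ φ ∈ Δ → ⊢ G ++⁺ ((Γ ⇒ Δ) ∷ (□⁻¹ Γ ⇒ [ φ ]) ∷ []) → ⊢ G ++⁺ ((Γ ⇒ Δ) ∷ H)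
⊢-□R {Δ = Δ} {Γ = Γ} G H □φ∈Δ ⊢φ =
  ⊢-append G (Γ ⇒ Δ) H
    (⊢-resp-at G (∼-refl , absorb □φ∈Δ) (infer₁ (rk (□R {H = G})) id (⊢-push G
      (subst (λ Λ → ⊢ G ++⁺ ((Γ ⇒ Δ) ∷ (Λ ⇒ _) ∷ [])) (sym (++-identityʳ (□⁻¹ Γ))) ⊢φ))))

-- Serial counter-examples

Refuted : Hypersequent → Set₁
Refuted H = Σ[ M ∈ Model ] Serial (frame M) × CounterExample M H

∅-refuted : Refuted (∅ ∷ [])
∅-refuted = record { frame = record { W = ⊤ ; R = λ _ _ → ⊤ ; inhabited = tt } ; V = λ _ _ → ⊤ }
          , (λ _ → tt , tt) , [ tt ] , [-] , ([] , []) ∷ []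

Refuted-head : (∀ M w → Countermodel M w S → Countermodel M w T) →
               Refuted (S ∷ H) → Refuted (T ∷ H)
Refuted-head f (M , ser , w ∷ ws , lnk , cm ∷ cms) = M , ser , w ∷ ws , lnk , f M w cm ∷ cms

Refuted-init : Refuted (S ∷ H) → Refuted (S ∷ [])
Refuted-init (M , ser , w ∷ ws , lnk , cm ∷ cms) = M , ser , [ w ] , [-] , cm ∷ []

Countermodel-resp : S ≈ˢ T → ∀ M w → Countermodel M w S → Countermodel M w T
Countermodel-resp (p , q) _ _ (γ , δ) = anti-mono (from p) γ , anti-mono (from q) δ

module Glue (I : Set) (M : I → Model) (pt : ∀ i → W (M i)) (V₀ : ℕ → Set) where

  Point : Set
  Point = Maybe (Σ[ i ∈ I ] W (M i))

  data Edge : Point → Point → Set where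
    root : ∀ i → Edge nothing (just (i , pt i))
    step : ∀ {i w v} → R (M i) w v → Edge (just (i , w)) (just (i , v))

  Val : ℕ → Point → Set
  Val p nothing        = V₀ p
  Val p (just (i , w)) = V (M i) p w

  glued : Model
  glued = record { frame = record { W = Point ; R = Edge ; inhabited = nothing } ; V = Val }

  -- Every edge out of a copy of `M i` stays in that copy.
  ⊨-glued : ∀ φ {i w} → (glued , just (i , w) ⊨ φ) ⇔ (M i , w ⊨ φ)
  ⊨-glued (var p)  = mk⇔ id id
  ⊨-glued (`¬ φ)   = mk⇔ (_∘ from (⊨-glued φ)) (_∘ to (⊨-glued φ))
  ⊨-glued (φ `∧ ψ) = mk⇔ (λ (a , b) → to (⊨-glued φ) a , to (⊨-glued ψ) b)
                         (λ (a , b) → from (⊨-glued φ) a , from (⊨-glued ψ) b)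
  ⊨-glued (□ φ)    = mk⇔ (λ f v r → to (⊨-glued φ) (f (just (_ , v)) (step r)))
                         (λ { f _ (step r) → from (⊨-glued φ) (f _ r) })

  Countermodel-glued : ∀ {i w} S → Countermodel (M i) w S → Countermodel glued (just (i , w)) S
  Countermodel-glued S (γ , δ) =
    All.map (λ {φ} → from (⊨-glued φ)) γ , All.map (λ {φ} → _∘ to (⊨-glued φ)) δ

  glued-serial : I → (∀ i → Serial (frame (M i))) → Serial (frame glued)
  glued-serial i₀ ser nothing        = just (i₀ , pt i₀) , root i₀
  glued-serial i₀ ser (just (i , w)) = let v , r = ser i w in just (i , v) , step r

-- Modal depth and reduced sequents

depth : Formula → ℕ
depth (var p)  = 0
depth (`¬ φ)   = depth φ
depth (φ `∧ ψ) = depth φ ⊔ depth ψ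
depth (□ φ)    = suc (depth φ)

data Literal (d : ℕ) : Formula → Set where
  var : ∀ p → Literal d (var p)
  box : ∀ {φ} → depth φ < d → Literal d (□ φ)

Shallow : ℕ → List Formula → Set
Shallow d = All (λ φ → depth φ < d)

□⁻¹-Shallow : All (Literal d) Γ → Shallow d (□⁻¹ Γ)
□⁻¹-Shallow []           = []
□⁻¹-Shallow (var _ ∷ ls) = □⁻¹-Shallow ls
□⁻¹-Shallow (box b ∷ ls) = b ∷ □⁻¹-Shallow ls

data Refutable (Γ : List Formula) : Formula → Set₁ where
  var : ∀ {p} → var p ∉ Γ → Refutable Γ (var p)
  box : ∀ {φ} → Refuted ((□⁻¹ Γ ⇒ [ φ ]) ∷ []) → Refutable Γ (□ φ)

Refutable-□⁻¹ : Refutable Γ (□ φ) → Refuted ((□⁻¹ Γ ⇒ [ φ ]) ∷ [])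
Refutable-□⁻¹ (box r) = r

-- All successors of the new root satisfy `□⁻¹ Γ`: one starts the given path, and each `□ φ` in `Δ`
-- has its own, refuting `φ`.
Refuted-glue : All (Literal d) Γ → All (Refutable Γ) Δ →
               Refuted ((□⁻¹ Γ ++ Λ ⇒ Θ) ∷ H) → Refuted ((Γ ⇒ Δ) ∷ (Λ ⇒ Θ) ∷ H)
Refuted-glue {d} {Γ} {Δ} {Λ} {Θ} {H} ls rs (M′ , ser′ , w′ ∷ ws , lnk , cm ∷ cms) =
  glued , glued-serial nothing serial
        , nothing ∷ map into (w′ ∷ ws) , root nothing ∷ LinkedProps.map⁺ (Linked.map step lnk)
        , (All.tabulate left , All.tabulate right)
        ∷ Countermodel-glued (Λ ⇒ Θ) (map₁ (++⁻ʳ (□⁻¹ Γ)) cm)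
        ∷ subst (Pointwise.Pointwise (Countermodel glued) _) (map-id H)
            (Pointwise.map⁺ into id (Pointwise.map (Countermodel-glued _) cms))
  where
  -- The index `nothing` stands for the model of the given path; it gives the root a successor even
  -- if `Δ` has no box.
  I : Set
  I = Maybe (Σ[ φ ∈ Formula ] □ φ ∈ Δ)

  Child : I → Set₁
  Child i = Σ[ M ∈ Model ] Serial (frame M) × Σ[ w ∈ W M ] All (M , w ⊨_) (□⁻¹ Γ) × Falsifies i M w
    where
    Falsifies : I → ∀ M → W M → Set
    Falsifies nothing        M w = ⊤
    Falsifies (just (φ , _)) M w = ¬ (M , w ⊨ φ)

  child : ∀ i → Child i
  child nothing = M′ , ser′ , w′ , ++⁻ˡ (□⁻¹ Γ) (proj₁ cm) , tt
  child (just (φ , □φ∈Δ)) with Refutable-□⁻¹ (All.lookup rs □φ∈Δ)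
  ... | M , ser , w ∷ _ , _ , (γ , δ) ∷ _ = M , ser , w , γ , singleton⁻ δ

  serial : ∀ i → Serial (frame (proj₁ (child i)))
  serial i = proj₁ (proj₂ (child i))

  -- The root makes exactly the variables in `Γ` true, so by `rs` those in `Δ` are false there.
  open Glue I (proj₁ ∘ child) (λ i → proj₁ (proj₂ (proj₂ (child i)))) (λ p → var p ∈ Γ)

  into : W M′ → Point
  into w = just (nothing , w)

  left : ∀ {φ} → φ ∈ Γ → glued , nothing ⊨ φ
  left φ∈Γ with All.lookup ls φ∈Γ
  ... | var p = φ∈Γ
  ... | box {φ} _ = λ { _ (root i) →
    from (⊨-glued φ) (All.lookup (proj₁ (proj₂ (proj₂ (proj₂ (child i))))) (∈-□⁻¹ φ∈Γ)) }

  right : ∀ {φ} → φ ∈ Δ → ¬ (glued , nothing ⊨ φ)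
  right φ∈Δ with All.lookup rs φ∈Δ
  ... | var p∉Γ = p∉Γ
  ... | box {φ} _ = λ f →
    let i = just (φ , φ∈Δ)
    in proj₂ (proj₂ (proj₂ (proj₂ (child i)))) (to (⊨-glued φ) (f _ (root i)))

-- Deciding hypersequents

-- Every prefix is allowed because the modal steps move the current sequent into the prefix.
Outcome : List Sequent → Sequent → Set₁
Outcome H S = (∀ G → ⊢ G ++⁺ (S ∷ H)) ⊎ Refuted (S ∷ H)

Outcome-map : (∀ G → ⊢ G ++⁺ (S ∷ H) → ⊢ G ++⁺ (T ∷ H)) →
              (∀ M w → Countermodel M w S → Countermodel M w T) →
              Outcome H S → Outcome H T
Outcome-map f g (inj₁ ⊢S) = inj₁ (λ G → f G (⊢S G))
Outcome-map f g (inj₂ r)  = inj₂ (Refuted-head g r)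

Outcome-resp : S ≈ˢ T → Outcome H S → Outcome H T
Outcome-resp e = Outcome-map (λ G → ⊢-resp-at G e) (Countermodel-resp e)

Outcome-∧R : Outcome H (Γ ⇒ φ ∷ Δ) → Outcome H (Γ ⇒ ψ ∷ Δ) → Outcome H (Γ ⇒ φ `∧ ψ ∷ Δ)
Outcome-∧R (inj₁ p) (inj₁ q) = inj₁ λ G → infer₂ (rk (∧R {G = G})) id (p G) (q G)
Outcome-∧R (inj₂ r) _        =
  inj₂ (Refuted-head (λ { _ _ (γ , δ ∷ δs) → γ , δ ∘ proj₁ ∷ δs }) r)
Outcome-∧R (inj₁ _) (inj₂ r) =
  inj₂ (Refuted-head (λ { _ _ (γ , δ ∷ δs) → γ , δ ∘ proj₂ ∷ δs }) r)

-- Propositional reduction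

module Reduction (d : ℕ) (H : List Sequent) where

  -- Γ and Δ are still to be reduced; A and B collect the literals already found.
  Reduced : List Formula → List Formula → Set₁
  Reduced Γ Δ = ∀ {A B} → All (Literal d) A → All (Literal d) B → Outcome H (Γ ++ A ⇒ Δ ++ B)

  -- Mutual recursion on the formula: negation switches sides at equal depth, and the continuation
  -- `k` treats the rest of the sequent.
  left  : ∀ φ → depth φ < suc d → Reduced Γ Δ → Reduced (φ ∷ Γ) Δ
  right : ∀ φ → depth φ < suc d → Reduced Γ Δ → Reduced Γ (φ ∷ Δ)

  left-literal : Literal d φ → Reduced Γ Δ → Reduced (φ ∷ Γ) Δ
  left-literal {Γ = Γ} l k a b =
    Outcome-resp (bag-=⇒ (↭⇒∼bag (shift _ Γ _)) , ∼-refl) (k (l ∷ a) b)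

  right-literal : Literal d φ → Reduced Γ Δ → Reduced Γ (φ ∷ Δ)
  right-literal {Δ = Δ} l k a b =
    Outcome-resp (∼-refl , bag-=⇒ (↭⇒∼bag (shift _ Δ _))) (k a (l ∷ b))

  left (var p)  _ k     = left-literal (var p) k
  left (`¬ φ)   h k a b =
    Outcome-map (λ G → infer₁ (rk (¬L {G = G})) id) (λ { _ _ (γ , δ ∷ δs) → δ ∷ γ , δs })
      (right φ h k a b)
  left (φ `∧ ψ) h k a b =
    Outcome-map ⊢-∧L (λ { _ _ (γ₁ ∷ γ₂ ∷ γ , δ) → (γ₁ , γ₂) ∷ γ , δ })
      (left φ (m⊔n<o⇒m<o (depth φ) (depth ψ) h) (left ψ (m⊔n<o⇒n<o (depth φ) (depth ψ) h) k) a b)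
  left (□ φ)    h k     = left-literal (box (s<s⁻¹ h)) k

  right (var p)  _ k     = right-literal (var p) k
  right (`¬ φ)   h k a b =
    Outcome-map (λ G → infer₁ (rk (¬R {G = G})) id)
      (λ { _ _ (γ ∷ γs , δ) → γs , (λ n → n γ) ∷ δ })
      (left φ h k a b)
  right (φ `∧ ψ) h k a b =
    Outcome-∧R (right φ (m⊔n<o⇒m<o (depth φ) (depth ψ) h) k a b)
               (right ψ (m⊔n<o⇒n<o (depth φ) (depth ψ) h) k a b)
  right (□ φ)    h k     = right-literal (box (s<s⁻¹ h)) k

  reduce : (∀ {Γ Δ} → All (Literal d) Γ → All (Literal d) Δ → Outcome H (Γ ⇒ Δ)) →
           Shallow (suc d) Γ → Shallow (suc d) Δ → Outcome H (Γ ⇒ Δ)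
  reduce {Γ} {Δ} k hΓ hΔ =
    subst₂ (λ Γ Δ → Outcome H (Γ ⇒ Δ)) (++-identityʳ Γ) (++-identityʳ Δ) (lefts hΓ [] [])
    where
    rights : ∀ {Δ} → Shallow (suc d) Δ → Reduced [] Δ
    rights []       = k
    rights (h ∷ hs) = right _ h (rights hs)
    lefts : ∀ {Γ} → Shallow (suc d) Γ → Reduced Γ Δ
    lefts []       = rights hΔ
    lefts (h ∷ hs) = left _ h (lefts hs)

all-or : {X : Set ℓ} {P : X → Set ℓ′} {C : Set ℓ″} {xs : List X} →
         (∀ {x} → x ∈ xs → C ⊎ P x) → C ⊎ All P xs
all-or {xs = []}     f = inj₂ []
all-or {xs = x ∷ xs} f with f (here refl) | all-or {xs = xs} (f ∘ there)
... | inj₁ c | _       = inj₁ c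
... | inj₂ _ | inj₁ c  = inj₁ c
... | inj₂ p | inj₂ ps = inj₂ (p ∷ ps)

var∈? : ∀ p (Γ : List Formula) → Dec (var p ∈ Γ)
var∈? p = any? (var≟ p)
  where
  var≟ : ∀ p (φ : Formula) → Dec (var p ≡ φ)
  var≟ p (var q)  = map′ (cong var) (λ { refl → refl }) (p ≟ q)
  var≟ p (`¬ _)   = no λ ()
  var≟ p (_ `∧ _) = no λ ()
  var≟ p (□ _)    = no λ ()

Decided : ℕ → List Sequent → Set₁
Decided d H = ∀ {Γ Δ} → Shallow d Γ → Shallow d Δ → Outcome H (Γ ⇒ Δ)

-- Testing a box of `Δ` concerns one component of smaller depth, so `dec` for the empty list serves
-- every `H`; `k` takes over when all of `Δ` is refutable.
outcome-suc : ∀ H → Decided d [] →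
  (∀ {Γ Δ} → All (Literal d) Γ → All (Refutable Γ) Δ → Outcome H (Γ ⇒ Δ)) →
  Decided (suc d) H
outcome-suc {d} H dec k = Reduction.reduce d H literals
  where
  literals : ∀ {Γ Δ} → All (Literal d) Γ → All (Literal d) Δ → Outcome H (Γ ⇒ Δ)
  literals {Γ} {Δ} lΓ lΔ with all-or succedents
    where
    succedents : ∀ {φ} → φ ∈ Δ → (∀ G → ⊢ G ++⁺ ((Γ ⇒ Δ) ∷ H)) ⊎ Refutable Γ φ
    succedents φ∈Δ with All.lookup lΔ φ∈Δ
    succedents φ∈Δ | var p with var∈? p Γ
    ... | yes p∈Γ = inj₁ λ G → ⊢-axiom G H p∈Γ φ∈Δ
    ... | no  p∉Γ = inj₂ (var p∉Γ)
    succedents φ∈Δ | box {φ} h with dec {□⁻¹ Γ} {[ φ ]} (□⁻¹-Shallow lΓ) (h ∷ [])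
    ... | inj₁ ⊢φ = inj₁ λ G → ⊢-□R G H φ∈Δ
                      (subst ⊢_ (++⁺-regroup G (Γ ⇒ Δ) (□⁻¹ Γ ⇒ [ φ ]) []) (⊢φ (G ++ [ Γ ⇒ Δ ])))
    ... | inj₂ r  = inj₂ (box r)
  ... | inj₁ ⊢S = inj₁ ⊢S
  ... | inj₂ rs = k lΓ rs

outcome-∷ : All (Literal d) Γ → All (Refutable Γ) Δ →
            Outcome H (□⁻¹ Γ ++ Λ ⇒ Θ) → Outcome ((Λ ⇒ Θ) ∷ H) (Γ ⇒ Δ)
outcome-∷ {Γ = Γ} {Δ} {H} {Λ} {Θ} ls rs (inj₁ ⊢T) = inj₁ λ G →
  ⊢-push G (subst ⊢_ (++⁺-regroup G (Γ ⇒ Δ) (□⁻¹ Γ ++ Λ ⇒ Θ) H) (⊢T (G ++ [ Γ ⇒ Δ ])))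
outcome-∷ ls rs (inj₂ r)  = inj₂ (Refuted-glue ls rs r)

outcome-drop : Outcome [ ∅ ] S → Outcome [] S
outcome-drop (inj₁ ⊢S) = inj₁ λ G → ⊢-drop G (⊢S G)
outcome-drop (inj₂ r)  = inj₂ (Refuted-init r)

-- Induction on depth: the component removed by `Drop` is empty, so the next sequent to decide is
-- just `□⁻¹ Γ ⇒ []`. At bound zero only the empty sequent remains.
decide₁ : ∀ d → Decided d []
decide₁ zero    []  []  = inj₂ ∅-refuted
decide₁ (suc d) = outcome-suc [] (decide₁ d) λ ls rs →
  outcome-drop (outcome-∷ ls rs (decide₁ d (All-++⁺ (□⁻¹-Shallow ls) []) []))

ShallowS : ℕ → Sequent → Set
ShallowS d (Γ ⇒ Δ) = Shallow d Γ × Shallow d Δ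

-- Induction on `H`: `□⁻¹ Γ` joins the next component, whose depth bound is kept while the list
-- shrinks.
decide : ∀ d H → All (ShallowS (suc d)) H → Decided (suc d) H
decide d []            []               = decide₁ (suc d)
decide d ((Λ ⇒ Θ) ∷ H) ((hΛ , hΘ) ∷ hs) = outcome-suc _ (decide₁ d) λ ls rs →
  outcome-∷ ls rs (decide d H hs (All-++⁺ (All.map m<n⇒m<1+n (□⁻¹-Shallow ls)) hΛ) hΘ)

formulas : Sequent → List Formula
formulas (Γ ⇒ Δ) = Γ ++ Δ

bound : List Sequent → ℕ
bound H = max 0 (map depth (concatMap formulas H))

bound-Shallow : ∀ H → All (ShallowS (suc (bound H))) H
bound-Shallow H =
  All.map (λ {S} → ++⁻ (antecedent S))
    -- The successor in the bound makes the inequality with the maximum strict.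
    (map⁻ (concat⁻ {xss = map formulas H} (All.map s≤s (map⁻ (xs≤max 0 (map depth (concatMap formulas H)))))))

mainTheorem3 : ∀ (H : Hypersequent) →
    (∀ (M : Model) → Serial (Model.frame M) → ¬ CounterExample M H) →
    Σ[ d ∈ Derivation RD H ] CutFree d
mainTheorem3 (S ∷ H) valid with bound-Shallow (S ∷ H)
... | (hΓ , hΔ) ∷ hs with decide _ H hs hΓ hΔ
...   | inj₁ ⊢S              = ⊢S []
...   | inj₂ (M , ser , cex) = ⊥-elim (valid M ser cex)
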